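{- Consider the variant of $\mathrm{OMP}_3(s,t)$ in which arbitrary nonnegative weights are placed on the online vertices (instead of on offline vertices) and the objective is to maximize the total weight of the matched online vertices. Then, for any budgets $s,t\in\mathbb N\cup\{\infty\}$, no deterministic online algorithm has a positive competitive ratio: for every deterministic online algorithm and every $\varepsilon>0$ there is an instance with positive optimum on which the algorithm's matching has weight at most $\varepsilon$ times the maximum weight of a matching.
   Context: An instance is a finite bipartite graph $G=(L,R,E)$, an arrival order $\pi$ of $R$, and weights $w:R\to\mathbb R_{\ge0}$. The offline side $L$ is known in advance; online vertices $j\in R$ arrive one by one in order $\pi$, and upon arrival of $j$ its weight and all edges incident to $j$ are revealed. The algorithm maintains a matching $M$, initially empty. A vertex is free if it is currently unmatched. The weight of a matching is the total weight of the online vertices it covers. $\mathrm{OMP}_3(s,t)$: upon arrival of $j$, the algorithm either leaves $j$ unmatched (forever, unless matched at this moment) or augments the current matching along an augmenting path of length $1$ or $3$ that starts at $j$ and ends at a free vertex of $L$. A length-1 path $[j~i]$ adds $ji$ with $i\in L$ free. A length-3 path $[j~x~y~i]$, with $x,i\in L$, $y\in R$, $xy\in M$, $i$ free, $jx,yi\in E$, replaces $M$ by $(M\setminus\{xy\})\cup\{jx,yi\}$; then $x$ and $y$ are each said to be reassigned once. Over the execution, each vertex of $L$ may be reassigned at most $s$ times and each vertex of $R$ at most $t$ times. No other change of the matching is allowed. A deterministic online algorithm is $\rho$-competitive if on every instance the weight of its final matching is at least $\rho$ times the maximum weight of a matching in $G$. -}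

module Defs where

open import Level using (Level; _⊔_) renaming (suc to lsuc)
open import Algebra.Apartness.Bundles using (HeytingField; module HeytingCommutativeRing)
open import Algebra.Bundles using (CommutativeRing)
import Algebra.Definitions.RawMonoid as RawMonoidDefinitions
open import Data.Fin.Base using (Fin; fromℕ; inject₁)
open import Data.Fin.Subset using (Subset; _∈_)
open import Data.Maybe.Base using (Maybe; just; nothing; maybe′)
open import Data.Nat.Base using (ℕ; zero; suc)
import Data.Nat.Base as ℕ
open import Data.Sum.Base using (_⊎_)
open import Data.Vec.Base using (Vec; lookup; replicate; updateAt; _[_]≔_; _∷ʳ_)
open import Function.Bundles using (_⇔_)
open import Relation.Binary.Core using (Rel)
open import Relation.Binary.PropositionalEquality.Core using (_≡_; _≢_)
open import Relation.Binary.Structures using (IsStrictPartialOrder)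
open import Relation.Nullary.Construct.Add.Supremum using (_⁺; [_])
import Relation.Binary.Construct.Add.Supremum.NonStrict as Supremum
open import Relation.Nullary.Negation.Core using (¬_)

-- The library has no real numbers, so weights live in an arbitrary ordered
-- field.  Phrased over a Heyting field, the axioms are met by ℚ and by the
-- real numbers, whether these are developed classically or constructively.
-- Classically they are the usual axioms of a linearly ordered field.
record OrderedField (c ℓ₁ ℓ₂ ℓ₃ : Level) : Set (lsuc (c ⊔ ℓ₁ ⊔ ℓ₂ ⊔ ℓ₃)) where
  field
    heytingField : HeytingField c ℓ₁ ℓ₂

  open HeytingField heytingField public

  open HeytingCommutativeRing heytingCommutativeRing public
    using (commutativeRing)

  open CommutativeRing commutativeRing public
    using (+-rawMonoid)

  infix 4 _<_ _≤_

  field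
    _<_                  : Rel Carrier ℓ₃
    isStrictPartialOrder : IsStrictPartialOrder _≈_ _<_
    #⇔<⊎>                : ∀ {x y} → x # y ⇔ (x < y ⊎ y < x)
    +-monoˡ-<            : ∀ {x y} z → x < y → x + z < y + z
    *-pos                : ∀ {x y} → 0# < x → 0# < y → 0# < x * y

  _≤_ : Rel Carrier ℓ₃
  x ≤ y = ¬ (y < x)

-- ℕ ∪ {∞}, where ∞ is ⊤⁺.
ℕ∞ : Set
ℕ∞ = ℕ ⁺

open Supremum ℕ._≤_ using (_≤⁺_)

module OMP {c ℓ₁ ℓ₂ ℓ₃ : Level} (F : OrderedField c ℓ₁ ℓ₂ ℓ₃) where

  open OrderedField F

  -- L is Fin m.  R together with its arrival order π is a finite linear order,
  -- hence is taken to be Fin n with its usual order: j is the (toℕ j)-th vertex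
  -- to arrive, counting from 0.  N j is the set of neighbours of j.
  record Instance (m n : ℕ) : Set (c ⊔ ℓ₃) where
    field
      N   : Fin n → Subset m
      w   : Fin n → Carrier
      w≥0 : ∀ j → 0# ≤ w j

  open Instance public

  -- What has been revealed before the arrival of the last online vertex.
  prefix : ∀ {m n} → Instance m (suc n) → Instance m n
  prefix I = record
    { N   = λ j → N I (inject₁ j)
    ; w   = λ j → w I (inject₁ j)
    ; w≥0 = λ j → w≥0 I (inject₁ j)
    }

  -- A set of edges covering each online vertex at most once, stored as the
  -- partner, if any, of each online vertex.
  Mates : ℕ → ℕ → Set
  Mates m n = Vec (Maybe (Fin m)) n

  record IsMatching {m n} (I : Instance m n) (M : Mates m n) : Set where
    field
      edges     : ∀ j i → lookup M j ≡ just i → i ∈ N I j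
      injective : ∀ j j′ i → lookup M j ≡ just i → lookup M j′ ≡ just i → j ≡ j′

  open RawMonoidDefinitions +-rawMonoid using (sum)

  weight : ∀ {m n} → Instance m n → Mates m n → Carrier
  weight I M = sum (λ j → maybe′ (λ _ → w I j) 0# (lookup M j))

  record IsMaximumMatching {m n} (I : Instance m n) (M : Mates m n) : Set ℓ₃ where
    field
      isMatching : IsMatching I M
      maximum    : ∀ M′ → IsMatching I M′ → weight I M′ ≤ weight I M

  -- The situation after n arrivals: the current matching, and how often each
  -- vertex has been reassigned so far.
  record State (m n : ℕ) : Set where
    field
      mates       : Mates m n
      reassignedL : Vec ℕ m
      reassignedR : Vec ℕ n

  open State public

  Free : ∀ {m n} → Mates m n → Fin m → Set
  Free M i = ∀ y → lookup M y ≢ just i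

  -- The options on arrival of the last online vertex j of I, in state σ.
  data Move (s t : ℕ∞) {m n} (I : Instance m (suc n)) (σ : State m n) : Set where
    leave    : Move s t I σ
    augment₁ : ∀ i →
               i ∈ N I (fromℕ n) →
               Free (mates σ) i →
               Move s t I σ
    augment₃ : ∀ x y i →
               x ∈ N I (fromℕ n) →
               lookup (mates σ) y ≡ just x →
               i ∈ N I (inject₁ y) →
               Free (mates σ) i →
               [ suc (lookup (reassignedL σ) x) ] ≤⁺ s →
               [ suc (lookup (reassignedR σ) y) ] ≤⁺ t →
               Move s t I σ

  initial : ∀ {m} → State m 0
  initial = record
    { mates       = replicate 0 nothing
    ; reassignedL = replicate _ 0
    ; reassignedR = replicate 0 0
    }

  after : ∀ {s t m n} {I : Instance m (suc n)} (σ : State m n) →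
          Move s t I σ → State m (suc n)
  after σ leave = record
    { mates       = mates σ ∷ʳ nothing
    ; reassignedL = reassignedL σ
    ; reassignedR = reassignedR σ ∷ʳ 0
    }
  after σ (augment₁ i _ _) = record
    { mates       = mates σ ∷ʳ just i
    ; reassignedL = reassignedL σ
    ; reassignedR = reassignedR σ ∷ʳ 0
    }
  after σ (augment₃ x y i _ _ _ _ _ _) = record
    { mates       = (mates σ [ y ]≔ just i) ∷ʳ just x
    ; reassignedL = updateAt (reassignedL σ) x suc
    ; reassignedR = updateAt (reassignedR σ) y suc ∷ʳ 0
    }

  -- A deterministic online algorithm for OMP₃(s,t): the instance passed to it
  -- is the part revealed so far, the total number of online vertices being
  -- unknown.  Its own past moves are determined by this information.  Having to
  -- answer in unreachable states is no restriction, as leave is always available.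
  OnlineAlgorithm : ℕ∞ → ℕ∞ → Set (c ⊔ ℓ₃)
  OnlineAlgorithm s t =
    ∀ {m n} (I : Instance m (suc n)) (σ : State m n) → Move s t I σ

  run : ∀ {s t} → OnlineAlgorithm s t → ∀ {m n} → Instance m n → State m n
  run A {n = zero}  I = initial
  run A {n = suc n} I = after σ (A I σ)
    where σ = run A (prefix I)

  value : ∀ {s t} → OnlineAlgorithm s t → ∀ {m n} → Instance m n → Carrier
  value A I = weight I (mates (run A I))

  _-Competitive_ : Carrier → ∀ {s t} → OnlineAlgorithm s t → Set (c ⊔ ℓ₃)
  ρ -Competitive A =
    ∀ {m n} (I : Instance m n) M → IsMaximumMatching I M →
    ρ * weight I M ≤ value A I

{-# OPTIONS --safe #-}
module Submission where

-- Once the only offline vertex is matched, it stays matched to the same online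
-- vertex, since no free vertex is left to end an augmenting path.  So let a
-- vertex of weight ε² arrive first: an algorithm that leaves it unmatched has
-- value 0, and one that matches it cannot take a second vertex of weight ε + ε²,
-- although ε² < ε (ε + ε²).  These weights, unlike 1 and 1 / ε, require neither
-- an inverse nor a comparison of ε with 1, which is undecidable in general.

open import Level using (Level)
open import Data.Empty using (⊥-elim)
open import Data.Fin.Base using (Fin; zero; suc)
open import Data.Fin.Properties using (0≢1+n)
open import Data.Fin.Subset using (⊤)
open import Data.Fin.Subset.Properties using (∈⊤)
open import Data.Maybe.Base using (just; nothing)
open import Data.Nat.Base using (ℕ)
open import Data.Product.Base using (_×_; _,_; Σ-syntax)
open import Data.Vec.Base using ([]; _∷_; _∷ʳ_; lookup)
open import Relation.Binary.PropositionalEquality.Core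
  using (_≡_; refl; sym; trans; cong; subst)
open import Relation.Binary.Structures using (IsStrictPartialOrder)
open import Relation.Nullary.Negation.Core using (¬_)
open import Defs

module Adversary {c ℓ₁ ℓ₂ ℓ₃ : Level} (F : OrderedField c ℓ₁ ℓ₂ ℓ₃) where

  open OrderedField F
    using ( Carrier; _≈_; _+_; _*_; 0#; _<_; _≤_
          ; isStrictPartialOrder; +-monoˡ-<; *-pos
          ; +-comm; +-congˡ; +-identityˡ; +-identityʳ; distribˡ; *-congˡ )
    renaming (refl to ≈-refl; sym to ≈-sym; trans to ≈-trans)
  open OMP F
  open IsStrictPartialOrder isStrictPartialOrder
    using (irrefl; asym; <-respˡ-≈; <-respʳ-≈)
    renaming (trans to <-trans)

  <-resp-≈ : ∀ {x x′ y y′} → x ≈ x′ → y ≈ y′ → x < y → x′ < y′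
  <-resp-≈ p q x<y = <-respˡ-≈ p (<-respʳ-≈ q x<y)

  <⇒≤ : ∀ {x y} → x < y → x ≤ y
  <⇒≤ = asym

  ≤-reflexive : ∀ {x y} → x ≈ y → x ≤ y
  ≤-reflexive x≈y = irrefl (≈-sym x≈y)

  x<y+x : ∀ {y} x → 0# < y → x < y + x
  x<y+x x 0<y = <-respˡ-≈ (+-identityˡ x) (+-monoˡ-< x 0<y)

  -- Both augmenting constructors carry a proof that the end of their path is free. Stated for an
  -- arbitrary move, so that the algorithm's second answer need not be inspected in `hardInstance`.
  saturated : ∀ {s t m n} {I : Instance m (ℕ.suc n)} {σ : State m n} →
              (∀ i → ¬ Free (mates σ) i) → (μ : Move s t I σ) →
              mates (after σ μ) ≡ mates σ ∷ʳ nothing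
  saturated noFree leave                           = refl
  saturated noFree (augment₁ i _ free)             = ⊥-elim (noFree i free)
  saturated noFree (augment₃ _ _ i _ _ _ free _ _) = ⊥-elim (noFree i free)

  -- The last inequality is strict because `≤` is defined as the negation of the reversed `<`: in
  -- this form it directly refutes `ε`-competitiveness and also weakens to the bound with `≤`.
  HardInstance : ∀ {s t} → OnlineAlgorithm s t → Carrier → Set _
  HardInstance A ε =
    Σ[ m ∈ ℕ ] Σ[ n ∈ ℕ ] Σ[ I ∈ Instance m n ] Σ[ M ∈ Mates m n ]
      IsMaximumMatching I M × 0# < weight I M × value A I < ε * weight I M

  module _ {ε : Carrier} (0<ε : 0# < ε) where

    0<ε² : 0# < ε * ε
    0<ε² = *-pos 0<ε 0<ε

    ε²<ε+ε² : ε * ε < ε + ε * ε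
    ε²<ε+ε² = x<y+x (ε * ε) 0<ε

    0<ε+ε² : 0# < ε + ε * ε
    0<ε+ε² = <-trans 0<ε² ε²<ε+ε²

    ε²<ε[ε+ε²] : ε * ε < ε * (ε + ε * ε)
    -- The right side expands to `ε * ε + ε * (ε * ε)`, so the surplus is the positive term
    -- `ε * (ε * ε)`.
    ε²<ε[ε+ε²] = <-respʳ-≈ (≈-trans (+-comm _ _) (≈-sym (distribˡ ε ε (ε * ε))))
      (x<y+x (ε * ε) (*-pos 0<ε 0<ε²))

    twoArrivals : Instance 1 2
    twoArrivals = record { N = λ _ → ⊤ ; w = w₂ ; w≥0 = w₂≥0 }
      where
      w₂ : Fin 2 → Carrier
      w₂ zero       = ε * ε
      w₂ (suc zero) = ε + ε * ε

      w₂≥0 : ∀ j → 0# ≤ w₂ j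
      w₂≥0 zero       = <⇒≤ 0<ε²
      w₂≥0 (suc zero) = <⇒≤ 0<ε+ε²

    -- Taken as a prefix so that `run A twoArrivals` unfolds to one move made after
    -- `run A oneArrival`: both instances elicit the same first answer.
    oneArrival : Instance 1 1
    oneArrival = prefix twoArrivals

    oneArrival-maximum : IsMaximumMatching oneArrival (just zero ∷ [])
    oneArrival-maximum = record
      { isMatching = record
        { edges     = λ { zero zero _ → ∈⊤ }
        ; injective = λ { zero zero _ _ _ → refl }
        }
      ; maximum    = λ
        -- The two weights unfold to `0# + 0#` and `ε * ε + 0#`, which is the shape monotonicity
        -- yields.
        { (nothing ∷ [])   _ → <⇒≤ (+-monoˡ-< 0# 0<ε²)
        ; (just zero ∷ []) _ → ≤-reflexive ≈-refl
        }
      }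

    weight-second : weight twoArrivals (nothing ∷ just zero ∷ []) ≈ ε + ε * ε
    weight-second = ≈-trans (+-identityˡ _) (+-identityʳ _)

    weight-first : weight twoArrivals (just zero ∷ nothing ∷ []) ≈ ε * ε
    weight-first = ≈-trans (+-congˡ (+-identityʳ 0#)) (+-identityʳ _)

    twoArrivals-maximum : IsMaximumMatching twoArrivals (nothing ∷ just zero ∷ [])
    twoArrivals-maximum = record
      { isMatching = record
        { edges     = λ { (suc zero) zero _ → ∈⊤ }
        ; injective = λ { (suc zero) (suc zero) _ _ _ → refl }
        }
      ; maximum    = λ
        { (nothing ∷ nothing ∷ [])     _ →
            <⇒≤ (<-resp-≈ (≈-sym (≈-trans (+-identityˡ _) (+-identityˡ 0#)))
                          (≈-sym weight-second) 0<ε+ε²)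
        ; (nothing ∷ just zero ∷ [])   _ → ≤-reflexive ≈-refl
        ; (just zero ∷ nothing ∷ [])   _ →
            <⇒≤ (<-resp-≈ (≈-sym weight-first) (≈-sym weight-second) ε²<ε+ε²)
        ; (just zero ∷ just zero ∷ []) isM →
            ⊥-elim (0≢1+n (IsMatching.injective isM zero (suc zero) zero refl refl))
        }
      }

    hardInstance : ∀ {s t} (A : OnlineAlgorithm s t) → HardInstance A ε
    -- The answer to the first arrival decides whether the adversary stops or sends the second
    -- vertex. The equation `first` is kept to compute `run` in each case.
    hardInstance A with A oneArrival initial in first
    -- A path of length 3 passes through an earlier online vertex, here an element of `Fin 0`.
    ... | augment₃ _ () _ _ _ _ _ _ _
    ... | leave = 1 , 1 , oneArrival , just zero ∷ [] , oneArrival-maximum ,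
      <-respʳ-≈ (≈-sym (+-identityʳ _)) 0<ε² , value<
      where
      unmatched : mates (run A oneArrival) ≡ nothing ∷ []
      unmatched = cong (λ μ → mates (after initial μ)) first

      value< : value A oneArrival < ε * weight oneArrival (just zero ∷ [])
      value< = subst (λ M → weight oneArrival M < _) (sym unmatched)
        (<-resp-≈ (≈-sym (+-identityʳ 0#)) (*-congˡ (≈-sym (+-identityʳ _)))
          (*-pos 0<ε 0<ε²))
    ... | augment₁ zero i∈N free =
      1 , 2 , twoArrivals , nothing ∷ just zero ∷ [] , twoArrivals-maximum ,
      <-respʳ-≈ (≈-sym weight-second) 0<ε+ε² , value<
      where
      matched : mates (run A oneArrival) ≡ just zero ∷ []
      matched = cong (λ μ → mates (after initial μ)) first

      noFree : ∀ i → ¬ Free (mates (run A oneArrival)) i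
      noFree zero isFree = isFree zero (cong (λ M → lookup M zero) matched)

      unchanged : mates (run A twoArrivals) ≡ just zero ∷ nothing ∷ []
      unchanged = trans (saturated noFree (A twoArrivals (run A oneArrival)))
                        (cong (_∷ʳ nothing) matched)

      value< : value A twoArrivals < ε * weight twoArrivals (nothing ∷ just zero ∷ [])
      value< = subst (λ M → weight twoArrivals M < _) (sym unchanged)
        (<-resp-≈ (≈-sym weight-first) (*-congˡ (≈-sym weight-second)) ε²<ε[ε+ε²])

mainTheorem7 : ∀ {c ℓ₁ ℓ₂ ℓ₃ : Level} (F : OrderedField c ℓ₁ ℓ₂ ℓ₃) →
    let open OrderedField F
        open OMP F
    in
    ∀ (s t : ℕ∞) (A : OnlineAlgorithm s t) →
    (∀ ρ → 0# < ρ → ¬ (ρ -Competitive A)) ×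
    (∀ ε → 0# < ε →
      Σ[ m ∈ ℕ ] Σ[ n ∈ ℕ ] Σ[ I ∈ Instance m n ] Σ[ M ∈ Mates m n ]
        IsMaximumMatching I M × 0# < weight I M × value A I ≤ ε * weight I M)
mainTheorem7 F s t A = notCompetitive , ratioAtMost
  where
  open OrderedField F
  open OMP F
  open Adversary F

  notCompetitive : ∀ ρ → 0# < ρ → ¬ (ρ -Competitive A)
  notCompetitive ρ 0<ρ competitive with hardInstance 0<ρ A
  -- With `ε` taken to be `ρ`, competitiveness on `I` is the negation of `value<`.
  ... | _ , _ , I , M , maximum , _ , value< = competitive I M maximum value<

  ratioAtMost : ∀ ε → 0# < ε →
    Σ[ m ∈ ℕ ] Σ[ n ∈ ℕ ] Σ[ I ∈ Instance m n ] Σ[ M ∈ Mates m n ]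
      IsMaximumMatching I M × 0# < weight I M × value A I ≤ ε * weight I M
  ratioAtMost ε 0<ε with hardInstance 0<ε A
  ... | m , n , I , M , maximum , positive , value< =
    m , n , I , M , maximum , positive , <⇒≤ value<
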